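{- Every connected locally Ore graph $G$ of order at least $3$ is fully cycle extendable.
   Context: All graphs are finite, simple, and undirected. $n(G)$ is the order of $G$; $N_G(u)$ is the (open) neighborhood and $d_G(u)$ the degree of $u$ in $G$. $G$ is locally Ore if $|N_G(u)\cap N_G(v)|+|N_G(u)\cap N_G(w)|\geq d_G(u)$ for every induced path $vuw$ of order $3$ in $G$ (that is, for all distinct vertices $u,v,w$ with $u$ adjacent to both $v$ and $w$, and $v$ not adjacent to $w$). A cycle $C$ in $G$ is extendable if $G$ contains a cycle $C'$ of order $n(C)+1$ with $V(C)\subseteq V(C')$. $G$ is fully cycle extendable if every vertex of $G$ lies on a triangle and every cycle in $G$ of order less than $n(G)$ is extendable. -}

module Defs where

open import Data.Fin using (Fin)
open import Data.Fin.Subset using (Subset; ∣_∣; _∩_)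
open import Data.List using (List; []; _∷_; _++_; length)
open import Data.List.Membership.Propositional using (_∈_)
open import Data.List.Relation.Binary.Subset.Propositional using (_⊆_)
open import Data.List.Relation.Unary.Linked using (Linked)
open import Data.List.Relation.Unary.Unique.Propositional using (Unique)
open import Data.Nat using (ℕ; suc; _+_; _≤_; _<_; _≥_)
open import Data.Product using (Σ-syntax; _×_)
open import Data.Vec using (tabulate)
open import Level using (0ℓ)
open import Relation.Binary using (Rel; Decidable; Symmetric; Irreflexive)
open import Relation.Binary.Construct.Closure.ReflexiveTransitive using (Star)
open import Relation.Binary.PropositionalEquality using (_≡_; _≢_)
open import Relation.Nullary using (¬_; does)

-- A finite simple graph of order n, with vertex set Fin n.
record Graph (n : ℕ) : Set₁ where
  infix 4 _~_ _~?_
  field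
    _~_      : Rel (Fin n) 0ℓ
    _~?_     : Decidable _~_
    ~-sym    : Symmetric _~_
    ~-irrefl : Irreflexive _≡_ _~_

module _ {n : ℕ} (G : Graph n) where
  open Graph G

  N : Fin n → Subset n
  N u = tabulate (λ v → does (u ~? v))

  deg : Fin n → ℕ
  deg u = ∣ N u ∣

  Connected : Set
  Connected = ∀ u v → Star _~_ u v

  LocallyOre : Set
  LocallyOre = ∀ u v w → u ≢ v → u ≢ w → v ≢ w →
               u ~ v → u ~ w → ¬ (v ~ w) →
               ∣ N u ∩ N v ∣ + ∣ N u ∩ N w ∣ ≥ deg u

  -- A cycle is given by a cyclic enumeration of its vertices, cut open at an
  -- arbitrary vertex.  The same cycle thus has several representations, all
  -- with the same order and vertex set.
  record Cycle : Set where
    field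
      start : Fin n
      rest  : List (Fin n)

    vertices : List (Fin n)
    vertices = start ∷ rest

    order : ℕ
    order = length vertices

    field
      3≤order  : 3 ≤ order
      distinct : Unique vertices
      adjacent : Linked _~_ (vertices ++ start ∷ [])

  open Cycle

  Extendable : Cycle → Set
  Extendable C = Σ[ C′ ∈ Cycle ]
    (order C′ ≡ suc (order C) × vertices C ⊆ vertices C′)

  OnTriangle : Fin n → Set
  OnTriangle v = Σ[ C ∈ Cycle ] (order C ≡ 3 × v ∈ vertices C)

  FullyCycleExtendable : Set
  FullyCycleExtendable =
    (∀ v → OnTriangle v) × (∀ C → order C < n → Extendable C)

{-# OPTIONS --safe #-}
module Submission where

-- Let C be a cycle missing a vertex x that has a neighbour on C.  Write a⁺ for
-- the successor of a on C, and W for the set of neighbours of x on C.  If C is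
-- not extendable, then for a, c ∈ W neither x nor c⁺ is adjacent to a⁺, and
-- every common neighbour of a, a⁺ and x lies on C, hence in W.  The Ore
-- condition for the induced path x a a⁺ is equivalent to
--   |N(a) ∩ N(x) ∩ N(a⁺)| ≥ |N(a) ∖ (N(x) ∪ N(a⁺))|.
-- The left-hand side is at most #{c ∈ W : c ~ a⁺}, while the right-hand side
-- is at least 1 + #{c ∈ W : a ~ c⁺}, as x itself is counted.  Summing over
-- a ∈ W, both counts become the number of pairs (a , c) in W with a ~ c⁺,
-- which is absurd.
--
-- By the same inequality, the ends of an induced path v u w have a common
-- neighbour with u.  Hence an edge u v without common neighbours would be a
-- whole component, so every edge lies on a triangle.

open import Defs
import Algebra.Properties.CommutativeSemigroup as CommutativeSemigroup
open import Data.Fin using (Fin)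
import Data.Fin.Properties as Fin
open import Data.Fin.Subset using (Subset; ∣_∣; _∩_; _∪_; ⋃; ∁; ⊤; ⁅_⁆; inside; outside)
  renaming (_∈_ to _∈ₛ_)
open import Data.Fin.Subset.Properties using
  (∣⊥∣≡0; ∣⊤∣≡n; ∣⁅x⁆∣≡1; x∈⁅x⁆; x∉p⇒x∈∁p; x∈p∩q⁺; x∈p∩q⁻; x∈p∪q⁺;
   p⊆q⇒∣p∣≤∣q∣; x∈p⇒∣p-x∣<∣p∣; x∈p∧x≢y⇒x∈p-y)
open import Data.List using (List; []; _∷_; _++_; length; map; filter; reverse)
open import Data.List.Membership.Propositional using (_∈_; _∉_; find; lose)
open import Data.List.Membership.Propositional.Properties using
  (∈-map⁺; ∈-map⁻; ∈-filter⁺; ∈-filter⁻)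
open import Data.List.Properties using (length-map; unfold-reverse)
open import Data.List.Relation.Binary.Permutation.Propositional using
  (_↭_; prep; swap; ↭-refl; ↭-reflexive; ↭-sym; ↭-trans; ↭⇒↭ₛ)
open import Data.List.Relation.Binary.Permutation.Propositional.Properties using
  (All-resp-↭; ∈-resp-↭; ↭-length; ++-comm; shift; ↭-reverse; ++⁺ʳ)
import Data.List.Relation.Binary.Permutation.Setoid.Properties as ↭ₛ
open import Data.List.Relation.Unary.All as All using (All; []; _∷_)
import Data.List.Relation.Unary.All.Properties as All
open import Data.List.Relation.Unary.AllPairs using ([]; _∷_)
import Data.List.Relation.Unary.AllPairs.Properties as AllPairs
open import Data.List.Relation.Unary.Any as Any using (here; there)
open import Data.List.Relation.Unary.Linked using (Linked; [-]; _∷_)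
open import Data.List.Relation.Unary.Unique.Propositional using (Unique)
open import Data.Nat using (ℕ; suc; _+_; _≤_; _<_; _≥_; z≤n; s≤s)
open import Data.Nat.ListAction using (sum)
open import Data.Nat.Properties as ℕ using (≤-trans; ≤-reflexive)
open import Data.Product using (∃; ∃₂; _×_; _,_; proj₁; proj₂; uncurry)
open import Data.Sum using (inj₁; inj₂)
open import Data.Vec using ([]; _∷_)
open import Data.Vec.Properties using (lookup∘tabulate; lookup⇒[]=; []=⇒lookup)
open import Function using (_∘_; case_of_)
open import Relation.Binary.Construct.Closure.ReflexiveTransitive using (Star; ε; _◅_)
open import Relation.Binary.PropositionalEquality
open import Relation.Nullary using (¬_; Dec; yes; no; contradiction; ¬?; _×-dec_)
open import Relation.Nullary.Decidable using (dec-true)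
open import Relation.Unary using (Decidable)

-- Cardinalities of subsets

∣p∪q∣≤∣p∣+∣q∣ : ∀ {n} (p q : Subset n) → ∣ p ∪ q ∣ ≤ ∣ p ∣ + ∣ q ∣
∣p∪q∣≤∣p∣+∣q∣ []            []            = z≤n
∣p∪q∣≤∣p∣+∣q∣ (outside ∷ p) (outside ∷ q) = ∣p∪q∣≤∣p∣+∣q∣ p q
∣p∪q∣≤∣p∣+∣q∣ (inside  ∷ p) (outside ∷ q) = s≤s (∣p∪q∣≤∣p∣+∣q∣ p q)
∣p∪q∣≤∣p∣+∣q∣ (outside ∷ p) (inside  ∷ q) =
  ≤-trans (s≤s (∣p∪q∣≤∣p∣+∣q∣ p q)) (≤-reflexive (sym (ℕ.+-suc ∣ p ∣ ∣ q ∣)))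
∣p∪q∣≤∣p∣+∣q∣ (inside  ∷ p) (inside  ∷ q) =
  s≤s (≤-trans (∣p∪q∣≤∣p∣+∣q∣ p q) (ℕ.+-monoʳ-≤ ∣ p ∣ (ℕ.n≤1+n ∣ q ∣)))

-- An element of `p` is counted once on each side, and twice if it lies in both `q` and `r`. The
-- additive form avoids truncated subtraction.
∩-inclusion-exclusion : ∀ {n} (p q r : Subset n) →
  ∣ p ∩ q ∣ + ∣ p ∩ r ∣ + ∣ p ∩ (∁ q ∩ ∁ r) ∣ ≡ ∣ p ∣ + ∣ p ∩ (q ∩ r) ∣
∩-inclusion-exclusion []            []            []            = refl
∩-inclusion-exclusion (outside ∷ p) (_       ∷ q) (_       ∷ r) =
  ∩-inclusion-exclusion p q r
∩-inclusion-exclusion (inside  ∷ p) (outside ∷ q) (outside ∷ r) =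
  trans (ℕ.+-suc _ _) (cong suc (∩-inclusion-exclusion p q r))
∩-inclusion-exclusion (inside  ∷ p) (inside  ∷ q) (outside ∷ r) =
  cong suc (∩-inclusion-exclusion p q r)
∩-inclusion-exclusion (inside  ∷ p) (outside ∷ q) (inside  ∷ r) =
  trans (cong (_+ ∣ p ∩ (∁ q ∩ ∁ r) ∣) (ℕ.+-suc _ _))
        (cong suc (∩-inclusion-exclusion p q r))
∩-inclusion-exclusion (inside  ∷ p) (inside  ∷ q) (inside  ∷ r) =
  cong suc (begin
    ∣ p ∩ q ∣ + suc ∣ p ∩ r ∣ + ∣ p ∩ (∁ q ∩ ∁ r) ∣
      ≡⟨ cong (_+ ∣ p ∩ (∁ q ∩ ∁ r) ∣) (ℕ.+-suc _ _) ⟩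
    suc (∣ p ∩ q ∣ + ∣ p ∩ r ∣ + ∣ p ∩ (∁ q ∩ ∁ r) ∣)
      ≡⟨ cong suc (∩-inclusion-exclusion p q r) ⟩
    suc (∣ p ∣ + ∣ p ∩ (q ∩ r) ∣)
      ≡⟨ ℕ.+-suc _ _ ⟨
    ∣ p ∣ + suc ∣ p ∩ (q ∩ r) ∣ ∎)
  where open ≡-Reasoning

-- Repetitions in `xs` do no harm: the union of its singletons gains at most one element per entry.
∣p∣≤length : ∀ {n} (p : Subset n) (xs : List (Fin n)) →
             (∀ {x} → x ∈ₛ p → x ∈ xs) → ∣ p ∣ ≤ length xs
∣p∣≤length {n} p xs p⊆xs = ≤-trans (p⊆q⇒∣p∣≤∣q∣ (∈-support ∘ p⊆xs)) (∣support∣≤length xs)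
  where
  support : List (Fin n) → Subset n
  support xs = ⋃ (map ⁅_⁆ xs)
  ∈-support : ∀ {x xs} → x ∈ xs → x ∈ₛ support xs
  ∈-support (here refl)  = x∈p∪q⁺ (inj₁ (x∈⁅x⁆ _))
  ∈-support (there x∈xs) = x∈p∪q⁺ (inj₂ (∈-support x∈xs))
  ∣support∣≤length : ∀ xs → ∣ support xs ∣ ≤ length xs
  ∣support∣≤length []       = ≤-reflexive (∣⊥∣≡0 n)
  ∣support∣≤length (x ∷ xs) = ≤-trans (∣p∪q∣≤∣p∣+∣q∣ ⁅ x ⁆ (support xs))
    (ℕ.+-mono-≤ (≤-reflexive (∣⁅x⁆∣≡1 x)) (∣support∣≤length xs))

length≤∣p∣ : ∀ {n} (p : Subset n) {xs : List (Fin n)} → Unique xs →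
             (∀ {x} → x ∈ xs → x ∈ₛ p) → length xs ≤ ∣ p ∣
length≤∣p∣ p []            xs⊆p = z≤n
length≤∣p∣ p (x∉xs ∷ xs!) xs⊆p = ≤-trans
  (s≤s (length≤∣p∣ _ xs! λ y∈xs →
    x∈p∧x≢y⇒x∈p-y (xs⊆p (there y∈xs)) (≢-sym (All.lookup x∉xs y∈xs))))
  (x∈p⇒∣p-x∣<∣p∣ (xs⊆p (here refl)))

-- Sums and filters over lists

module _ {A : Set} where

  sum-map-mono-≤ : ∀ (f g : A → ℕ) {xs} → All (λ x → f x ≤ g x) xs →
                   sum (map f xs) ≤ sum (map g xs)
  sum-map-mono-≤ f g []         = z≤n
  sum-map-mono-≤ f g (le ∷ les) = ℕ.+-mono-≤ le (sum-map-mono-≤ f g les)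

  -- The member `x` excludes the empty list, on which both sums are zero.
  sum-map-mono-< : ∀ (f g : A → ℕ) {x xs} → x ∈ xs → All (λ y → f y < g y) xs →
                   sum (map f xs) < sum (map g xs)
  sum-map-mono-< f g {xs = _ ∷ _} _ (lt ∷ lts) =
    ℕ.+-mono-<-≤ lt (sum-map-mono-≤ f g (All.map ℕ.<⇒≤ lts))

  map-filter-unique : ∀ {B : Set} {P : A → Set} (P? : Decidable P) (f : A → B) {xs} →
                      Unique (map f xs) → Unique (map f (filter P? xs))
  map-filter-unique P? f = AllPairs.map⁺ ∘ AllPairs.filter⁺ P? ∘ AllPairs.map⁻

  double-count : ∀ {B : Set} {R : A → B → Set} (R? : ∀ a b → Dec (R a b)) as bs →
    sum (map (λ a → length (filter (R? a) bs)) as) ≡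
    sum (map (λ b → length (filter (λ a → R? a b) as)) bs)
  double-count R? [] []       = refl
  double-count R? [] (_ ∷ bs) = double-count R? [] bs
  double-count {B} R? (a ∷ as) bs =
    trans (cong (row bs +_) (double-count R? as bs)) (split bs)
    where
    open CommutativeSemigroup ℕ.+-commutativeSemigroup using (x∙yz≈y∙xz)
    row : List B → ℕ
    row bs = length (filter (R? a) bs)
    column : List A → B → ℕ
    column as b = length (filter (λ a → R? a b) as)
    -- A new row `a` lengthens the column of `b` by one exactly when `R a b` holds, and `row` counts
    -- these `b`.
    split : ∀ bs → row bs + sum (map (column as) bs) ≡ sum (map (column (a ∷ as)) bs)
    split [] = refl
    split (b ∷ bs)
      with R? a b | trans (x∙yz≈y∙xz (row bs) (column as b) (sum (map (column as) bs)))
                          (cong (column as b +_) (split bs))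
    ... | yes _ | eq = cong suc eq
    ... | no  _ | eq = eq

-- Trails

module _ {A : Set} where

  -- The arcs of the walk from `a` through `xs` to `b`. A cycle cut open at `s` becomes
  -- `trail s r s`, closing arc included. Adjacency is then an `All` over arcs, which survives
  -- permutation.
  trail : A → List A → A → List (A × A)
  trail a []       b = (a , b) ∷ []
  trail a (x ∷ xs) b = (a , x) ∷ trail x xs b

  trail-++ : ∀ a xs y ys b → trail a (xs ++ y ∷ ys) b ≡ trail a xs y ++ trail y ys b
  trail-++ a []       y ys b = refl
  trail-++ a (x ∷ xs) y ys b = cong ((a , x) ∷_) (trail-++ x xs y ys b)

  trail-sources : ∀ a xs b → map proj₁ (trail a xs b) ≡ a ∷ xs
  trail-sources a []       b = refl
  trail-sources a (x ∷ xs) b = cong (a ∷_) (trail-sources x xs b)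

  trail-targets : ∀ a xs b → map proj₂ (trail a xs b) ≡ xs ++ b ∷ []
  trail-targets a []       b = refl
  trail-targets a (x ∷ xs) b = cong (x ∷_) (trail-targets x xs b)

  module _ {R : A → A → Set} where

    linked⇒trail : ∀ a xs b → Linked R (a ∷ xs ++ b ∷ []) → All (uncurry R) (trail a xs b)
    linked⇒trail a []       b (r ∷ _)  = r ∷ []
    linked⇒trail a (x ∷ xs) b (r ∷ rs) = r ∷ linked⇒trail x xs b rs

    trail⇒linked : ∀ a xs b → All (uncurry R) (trail a xs b) → Linked R (a ∷ xs ++ b ∷ [])
    trail⇒linked a []       b (r ∷ _)  = r ∷ [-]
    trail⇒linked a (x ∷ xs) b (r ∷ rs) = r ∷ trail⇒linked x xs b rs

    trail-reverse : (∀ {x y} → R x y → R y x) → ∀ a xs b →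
                    All (uncurry R) (trail a xs b) → All (uncurry R) (trail b (reverse xs) a)
    trail-reverse R-sym a []       b (r ∷ _) = R-sym r ∷ []
    trail-reverse R-sym a (x ∷ xs) b (r ∷ rs)
      rewrite unfold-reverse x xs | trail-++ b (reverse xs) x [] a
      = All.++⁺ (trail-reverse R-sym x xs b rs) (R-sym r ∷ [])

  -- The ends `a` and `b` are not part of the interior list, so how an arc splits that list depends
  -- on whether it is the first arc, the last, both or neither.
  data ArcPosition (a b : A) : A → A → List A → Set where
    only  :                       ArcPosition a b a b []
    first : ∀ {d} q →             ArcPosition a b a d (d ∷ q)
    last  : ∀ {c} p →             ArcPosition a b c b (p ++ c ∷ [])
    inner : ∀ {c d} p q →         ArcPosition a b c d (p ++ c ∷ d ∷ q)

  arcPosition : ∀ {a b c d} xs → (c , d) ∈ trail a xs b → ArcPosition a b c d xs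
  arcPosition []       (here refl) = only
  arcPosition (x ∷ xs) (here refl) = first xs
  arcPosition (x ∷ xs) (there i) with arcPosition xs i
  ... | only      = last []
  ... | first q   = inner [] q
  ... | last p    = last (x ∷ p)
  ... | inner p q = inner (x ∷ p) q

  -- Cuts the closed walk open again at `a`. Recording the rotation as permutations suffices, since
  -- distinctness, membership and adjacency all respect them. The hypothesis `a ≢ b` rules out the
  -- loop at a single vertex.
  rotate-to-arc : ∀ {a b} s r → a ≢ b → (a , b) ∈ trail s r s →
    ∃ λ q → s ∷ r ↭ a ∷ b ∷ q × trail s r s ↭ (a , b) ∷ trail b q a
  rotate-to-arc {a} {b} s r a≢b i with arcPosition r i
  ... | only      = contradiction refl a≢b
  ... | first q   = q , ↭-refl , ↭-refl
  ... | last p    = p , ++-comm (s ∷ p) (a ∷ []) ,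
    ↭-trans (↭-reflexive (trail-++ s p a [] s)) (++-comm (trail s p a) _)
  ... | inner p q = q ++ s ∷ p , ++-comm (s ∷ p) (a ∷ b ∷ q) ,
    ↭-trans (↭-reflexive (trail-++ s p a (b ∷ q) s))
      (↭-trans (++-comm (trail s p a) _)
        (prep _ (↭-reflexive (sym (trail-++ b q s p a)))))

  Unique-resp-↭ : ∀ {xs ys : List A} → xs ↭ ys → Unique xs → Unique ys
  Unique-resp-↭ = ↭ₛ.Unique-resp-↭ (setoid A) ∘ ↭⇒↭ₛ

-- Neighbourhoods, boundary edges and the Ore inequality

module _ {n : ℕ} (G : Graph n) where
  open Graph G
  open Cycle
  open import Data.List.Membership.DecPropositional (Fin._≟_ {n}) using (_∈?_)

  ∈N⁺ : ∀ {u v} → u ~ v → v ∈ₛ N G u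
  ∈N⁺ {u} {v} u~v = lookup⇒[]= v _ (trans (lookup∘tabulate _ v) (dec-true (u ~? v) u~v))

  ∈N⁻ : ∀ {u v} → v ∈ₛ N G u → u ~ v
  ∈N⁻ {u} {v} v∈N with u ~? v | trans (sym (lookup∘tabulate _ v)) ([]=⇒lookup v∈N)
  ... | yes u~v | _ = u~v

  -- Some vertex is missing from so short a list, and a path from `x` to it must leave `xs`.
  connected⇒boundary : Connected G → ∀ {x xs} → x ∈ xs → length xs < n →
    ∃₂ λ y z → y ∈ xs × z ∉ xs × y ~ z
  connected⇒boundary conn {x} {xs} x∈xs short = leave x∈xs (conn x (proj₁ missing))
    where
    missing : ∃ λ z → z ∉ xs
    missing = Fin.¬∀⟶∃¬ n (_∈ xs) (_∈? xs) λ all →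
      ℕ.<⇒≱ short (subst (_≤ length xs) (∣⊤∣≡n n) (∣p∣≤length ⊤ xs (λ {z} _ → all z)))
    leave : ∀ {y} → y ∈ xs → Star _~_ y (proj₁ missing) → ∃₂ λ y z → y ∈ xs × z ∉ xs × y ~ z
    leave y∈xs ε = contradiction y∈xs (proj₂ missing)
    leave y∈xs (_◅_ {j = z} y~z path) with z ∈? xs
    ... | yes z∈xs = leave z∈xs path
    ... | no  z∉xs = _ , z , y∈xs , z∉xs , y~z

  -- The Ore condition for the induced path `v u w`, after cancelling `deg G u`: at least as many
  -- neighbours of `u` see both ends as see neither. Lists stand in for these two sets, `xs`
  -- covering the first and `ys` sampling the second without repetition.
  ore-bound : LocallyOre G → ∀ {u v w} → u ~ v → u ~ w → v ≢ w → ¬ (v ~ w) → ∀ xs {ys} →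
    (∀ {z} → u ~ z → v ~ z → w ~ z → z ∈ xs) →
    Unique ys → (∀ {z} → z ∈ ys → u ~ z × ¬ (v ~ z) × ¬ (w ~ z)) →
    length ys ≤ length xs
  ore-bound ore {u} {v} {w} u~v u~w v≢w v≁w xs {ys} common ys! private′ = begin
    length ys                                ≤⟨ length≤∣p∣ _ ys! ys⊆ ⟩
    ∣ N G u ∩ (∁ (N G v) ∩ ∁ (N G w)) ∣      ≤⟨ ℕ.+-cancelˡ-≤ (deg G u) _ _ counts ⟩
    ∣ N G u ∩ (N G v ∩ N G w) ∣              ≤⟨ ∣p∣≤length _ xs ⊆xs ⟩
    length xs                                ∎
    where
    open ℕ.≤-Reasoning
    ~⇒≢ : ∀ {a b} → a ~ b → a ≢ b
    ~⇒≢ a~b a≡b = ~-irrefl a≡b a~b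
    counts : deg G u + ∣ N G u ∩ (∁ (N G v) ∩ ∁ (N G w)) ∣ ≤
             deg G u + ∣ N G u ∩ (N G v ∩ N G w) ∣
    counts = ≤-trans
      (ℕ.+-monoˡ-≤ _ (ore u v w (~⇒≢ u~v) (~⇒≢ u~w) v≢w u~v u~w v≁w))
      (≤-reflexive (∩-inclusion-exclusion (N G u) (N G v) (N G w)))
    ys⊆ : ∀ {z} → z ∈ ys → z ∈ₛ N G u ∩ (∁ (N G v) ∩ ∁ (N G w))
    ys⊆ z∈ys = case private′ z∈ys of λ (u~z , v≁z , w≁z) →
      x∈p∩q⁺ (∈N⁺ u~z , x∈p∩q⁺ (x∉p⇒x∈∁p (v≁z ∘ ∈N⁻) , x∉p⇒x∈∁p (w≁z ∘ ∈N⁻)))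
    ⊆xs : ∀ {z} → z ∈ₛ N G u ∩ (N G v ∩ N G w) → z ∈ xs
    ⊆xs z∈ = case x∈p∩q⁻ (N G u) _ z∈ of λ (z∈Nu , z∈Nv∩Nw) →
      case x∈p∩q⁻ (N G v) (N G w) z∈Nv∩Nw of λ (z∈Nv , z∈Nw) →
      common (∈N⁻ z∈Nu) (∈N⁻ z∈Nv) (∈N⁻ z∈Nw)

  -- Triangles

  adjacent⇒common-neighbour : LocallyOre G → Connected G → n ≥ 3 → ∀ {u v} → u ~ v →
    ∃ λ z → u ~ z × v ~ z
  adjacent⇒common-neighbour ore conn n≥3 {u} {v} u~v
    with Fin.any? (λ z → (u ~? z) ×-dec (v ~? z))
  ... | yes found = found
  ... | no  none with connected⇒boundary conn {u} {u ∷ v ∷ []} (here refl) n≥3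
  ...   | y , w , y∈uv , w∉uv , y~w = contradiction (pendant y∈uv) λ ()
    where
    -- The path `b a w` is induced, and `b` itself is a neighbour of `a` adjacent to neither end.
    -- With no common neighbours to balance it, the Ore bound fails.
    1≤0 : ∀ {a b} → a ~ b → a ~ w → w ≢ b → ¬ (∃ λ z → a ~ z × b ~ z) → 1 ≤ 0
    1≤0 a~b a~w w≢b none′ =
      ore-bound ore a~b a~w (≢-sym w≢b) (λ b~w → none′ (_ , a~w , b~w)) []
        (λ a~z b~z _ → contradiction (_ , a~z , b~z) none′)
        ([] ∷ [])
        (λ { (here refl) → a~b , ~-irrefl refl , λ w~b → none′ (_ , a~w , ~-sym w~b) })
    pendant : y ∈ u ∷ v ∷ [] → 1 ≤ 0
    pendant (here refl)         = 1≤0 u~v y~w (w∉uv ∘ there ∘ here) none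
    pendant (there (here refl)) = 1≤0 (~-sym u~v) y~w (w∉uv ∘ here)
      (λ (z , v~z , u~z) → none (z , u~z , v~z))

  onTriangle : LocallyOre G → Connected G → n ≥ 3 → ∀ v → OnTriangle G v
  onTriangle ore conn n≥3 v
    with connected⇒boundary conn {v} {v ∷ []} (here refl) (≤-trans (s≤s (s≤s z≤n)) n≥3)
  ... | _ , u , here refl , _ , v~u with adjacent⇒common-neighbour ore conn n≥3 v~u
  ...   | z , v~z , u~z = record
    { start    = v
    ; rest     = u ∷ z ∷ []
    ; 3≤order  = ℕ.≤-refl
    ; distinct = ((λ { refl → ~-irrefl refl v~u }) ∷ (λ { refl → ~-irrefl refl v~z }) ∷ [])
               ∷ ((λ { refl → ~-irrefl refl u~z }) ∷ []) ∷ [] ∷ []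
    ; adjacent = v~u ∷ u~z ∷ ~-sym v~z ∷ [-]
    } , refl , here refl

  -- Ways of extending a cycle

  module _ (C : Cycle G) where

    arcs : List (Fin n × Fin n)
    arcs = trail (start C) (rest C) (start C)

    arcs-adjacent : All (uncurry _~_) arcs
    arcs-adjacent = linked⇒trail (start C) (rest C) (start C) (adjacent C)

    arc⇒≢ : ∀ {a b} → (a , b) ∈ arcs → a ≢ b
    arc⇒≢ i a≡b = ~-irrefl a≡b (All.lookup arcs-adjacent i)

    sources-unique : Unique (map proj₁ arcs)
    sources-unique =
      subst Unique (sym (trail-sources (start C) (rest C) (start C))) (distinct C)

    targets-unique : Unique (map proj₂ arcs)
    targets-unique = subst Unique (sym (trail-targets (start C) (rest C) (start C)))
      (Unique-resp-↭ (++-comm (start C ∷ []) (rest C)) (distinct C))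

    arc-from : ∀ {a} → a ∈ vertices C → ∃ λ b → (a , b) ∈ arcs
    arc-from a∈C
      with ∈-map⁻ proj₁ (subst (_ ∈_) (sym (trail-sources (start C) (rest C) (start C))) a∈C)
    ... | (_ , b) , i , refl = b , i

    -- The permutation alone yields the order, the distinctness and the inclusion of vertices, so
    -- only adjacency has to be checked for each new cycle.
    extend-by : ∀ {z} → z ∉ vertices C → ∀ s r → s ∷ r ↭ z ∷ vertices C →
                All (uncurry _~_) (trail s r s) → Extendable G C
    extend-by {z} z∉C s r perm adj = record
      { start    = s
      ; rest     = r
      ; 3≤order  = subst (3 ≤_) (sym (↭-length perm)) (ℕ.m≤n⇒m≤1+n (3≤order C))
      ; distinct = Unique-resp-↭ (↭-sym perm)
          (All.tabulate (λ { y∈C refl → z∉C y∈C }) ∷ distinct C)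
      ; adjacent = trail⇒linked s r s adj
      } , ↭-length perm , ∈-resp-↭ (↭-sym perm) ∘ there

    extend-by-insertion : ∀ {z a b} → z ∉ vertices C → (a , b) ∈ arcs → a ~ z → z ~ b →
                          Extendable G C
    extend-by-insertion {z} {a} {b} z∉C i a~z z~b
      with rotate-to-arc (start C) (rest C) (arc⇒≢ i) i
    ... | q , perm , arcs↭ = extend-by z∉C a (z ∷ b ∷ q)
      (↭-trans (swap a z ↭-refl) (prep z (↭-sym perm)))
      (a~z ∷ z~b ∷ All.tail (All-resp-↭ arcs↭ arcs-adjacent))

    -- With C = a b P c d Q, the new cycle is a x c P⁻¹ b d Q.
    extend-by-crossing : ∀ {x a b c d} → x ∉ vertices C → (a , b) ∈ arcs → (c , d) ∈ arcs →
      x ~ a → x ~ c → b ~ d → ¬ (x ~ b) → ¬ (x ~ d) → Extendable G C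
    extend-by-crossing {x} {a} {b} {c} {d} x∉C i j x~a x~c b~d x≁b x≁d
      with rotate-to-arc (start C) (rest C) (arc⇒≢ i) i
    ... | q , perm , arcs↭ with ∈-resp-↭ arcs↭ j | All-resp-↭ arcs↭ arcs-adjacent
    -- The two arcs coincide, so `b` would be adjacent to itself.
    ...   | here refl | _ = contradiction b~d (~-irrefl refl)
    ...   | there k | _ ∷ adj with arcPosition q k
    -- In these three cases `c` is `b` or `d` is `a`, against `x` being adjacent to `a` and `c` but
    -- not to `b` or `d`.
    ...     | only     = contradiction x~c x≁b
    ...     | first _  = contradiction x~c x≁b
    ...     | last _   = contradiction x~a x≁d
    ...     | inner p q′ = extend-by x∉C a (x ∷ c ∷ reverse p ++ b ∷ d ∷ q′)
      (↭-trans (swap a x (↭-trans (prep c (shift b (reverse p) (d ∷ q′)))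
        (swap c b (++⁺ʳ (d ∷ q′) (↭-reverse p)))))
        (prep x (↭-trans (prep a (prep b (↭-sym (shift c p (d ∷ q′))))) (↭-sym perm))))
      (~-sym x~a ∷ x~c ∷ subst (All _) (sym (trail-++ c (reverse p) b (d ∷ q′) a))
        (All.++⁺ (trail-reverse ~-sym b p c (All.++⁻ˡ (trail b p c) adj′))
          -- The tail drops the arc from `c` to `d`, whose place is taken by the edge from `b` to
          -- `d`.
          (b~d ∷ All.tail (All.++⁻ʳ (trail b p c) adj′))))
      where adj′ = subst (All _) (trail-++ b p c (d ∷ q′) a) adj

    -- The counting argument

    extendable : LocallyOre G → Connected G → order C < n → Extendable G C
    extendable ore conn short
      with connected⇒boundary conn {start C} {vertices C} (here refl) short
    ... | a₀ , x , a₀∈C , x∉C , a₀~x = conclude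
      where
      -- `P` holds the arcs from a vertex of W to its successor. For the relation between arcs
      -- `(a , b)` and `(c , d)` given by `a ~ d`, `forth` lists a row and `back` a column.
      P? : Decidable (λ ((a , b) : Fin n × Fin n) → x ~ a)
      P? (a , b) = x ~? a
      P = filter P? arcs
      back forth : Fin n × Fin n → List (Fin n × Fin n)
      back  (a , b) = filter (λ (c , d) → c ~? b) P
      forth (a , b) = filter (λ (c , d) → a ~? d) P

      -- Apply `ore-bound` to the induced path `x a b`. Common neighbours lie on the cycle, hence
      -- are sources in `back`; the targets in `forth` are adjacent to neither end. So is `x`, which
      -- makes the inequality strict.
      stuck : (∀ {a b} → (a , b) ∈ P → ¬ (x ~ b)) →
              (∀ {a b c d} → (a , b) ∈ P → (c , d) ∈ P → ¬ (b ~ d)) →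
              (∀ {a b z} → (a , b) ∈ P → a ~ z → z ~ b → z ∈ vertices C) →
              ∀ {p} → p ∈ P → length (forth p) < length (back p)
      stuck x≁ successors-independent common∈C {a , b} p∈P =
        subst₂ (λ k l → suc k ≤ l) (length-map proj₂ (forth (a , b)))
          (length-map proj₁ (back (a , b)))
          (ore-bound ore (~-sym x~a) a~b x≢b (x≁ p∈P) (map proj₁ (back (a , b))) common
            (x∉forth ∷ map-filter-unique (λ (c , d) → a ~? d) proj₂
              (map-filter-unique P? proj₂ targets-unique))
            private′)
        where
        i = proj₁ (∈-filter⁻ P? p∈P)
        x~a = proj₂ (∈-filter⁻ P? {xs = arcs} p∈P)
        a~b = All.lookup arcs-adjacent i
        target∈C : ∀ {c d} → (c , d) ∈ arcs → d ∈ vertices C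
        target∈C j = ∈-resp-↭ (++-comm (rest C) (start C ∷ []))
          (subst (_ ∈_) (trail-targets (start C) (rest C) (start C)) (∈-map⁺ proj₂ j))
        x≢b : x ≢ b
        x≢b refl = x∉C (target∈C i)
        x∉forth : All (x ≢_) (map proj₂ (forth (a , b)))
        x∉forth = All.tabulate λ { d∈ refl → case ∈-map⁻ proj₂ d∈ of λ
          { (_ , q∈ , refl) → x∉C (target∈C (proj₁ (∈-filter⁻ P?
              (proj₁ (∈-filter⁻ (λ (c , d) → a ~? d) {xs = P} q∈))))) } }
        common : ∀ {z} → a ~ z → x ~ z → b ~ z → z ∈ map proj₁ (back (a , b))
        common a~z x~z b~z = case arc-from (common∈C p∈P a~z (~-sym b~z)) of λ (_ , k) →
          ∈-map⁺ proj₁ (∈-filter⁺ (λ (c , d) → c ~? b) (∈-filter⁺ P? k x~z) (~-sym b~z))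
        private′ : ∀ {z} → z ∈ x ∷ map proj₂ (forth (a , b)) → a ~ z × ¬ (x ~ z) × ¬ (b ~ z)
        private′ (here refl) = ~-sym x~a , ~-irrefl refl , x≁ p∈P ∘ ~-sym
        private′ (there z∈) with ∈-map⁻ proj₂ z∈
        ... | _ , q∈ , refl with ∈-filter⁻ (λ (c , d) → a ~? d) {xs = P} q∈
        ...   | q∈P , a~d = a~d , x≁ q∈P , successors-independent p∈P q∈P

      conclude : Extendable G C
      -- A hit in any of the three searches extends the cycle; their three failures are the
      -- hypotheses of `stuck`.
      conclude with Any.any? (λ (a , b) → x ~? b) P
      ... | yes some = case find some of λ (_ , p∈P , x~b) →
        case ∈-filter⁻ P? p∈P of λ (i , x~a) → extend-by-insertion x∉C i (~-sym x~a) x~b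
      ... | no x≁ with Any.any? (λ (a , b) → Any.any? (λ (c , d) → b ~? d) P) P
      ...   | yes some = case find some of λ (_ , p∈P , some′) →
        case find some′ of λ (_ , q∈P , b~d) →
        case ∈-filter⁻ P? p∈P of λ (i , x~a) → case ∈-filter⁻ P? q∈P of λ (j , x~c) →
        extend-by-crossing x∉C i j x~a x~c b~d (x≁ ∘ lose p∈P) (x≁ ∘ lose q∈P)
      ...   | no b≁d
        with Any.any? (λ (a , b) → Fin.any? (λ z →
               ¬? (z ∈? vertices C) ×-dec (a ~? z) ×-dec (z ~? b))) P
      ...     | yes some = case find some of λ (_ , p∈P , z , z∉C , a~z , z~b) →
        extend-by-insertion z∉C (proj₁ (∈-filter⁻ P? p∈P)) a~z z~b
      -- Rows and columns have equal totals, yet every row is shorter than the matching column. The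
      -- arc leaving `a₀` shows that `P` is nonempty.
      ...     | no outside-none = contradiction
        (double-count (λ (a , b) (c , d) → a ~? d) P P)
        (ℕ.<⇒≢ (sum-map-mono-< (length ∘ forth) (length ∘ back)
          (∈-filter⁺ P? (proj₂ (arc-from a₀∈C)) (~-sym a₀~x))
          (All.tabulate (stuck
            (λ p∈P → x≁ ∘ lose p∈P)
            (λ p∈P q∈P b~d → b≁d (lose p∈P (lose q∈P b~d)))
            (λ {a} {b} {z} p∈P a~z z~b → case z ∈? vertices C of λ
              { (yes z∈C) → z∈C
              ; (no  z∉C) → contradiction
                  (lose p∈P (z , z∉C , a~z , z~b)) outside-none })))))

corollary10 : (n : ℕ) (G : Graph n) → n ≥ 3 → Connected G → LocallyOre G → FullyCycleExtendable G
corollary10 n G n≥3 conn ore = onTriangle G ore conn n≥3 , λ C → extendable G C ore conn
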